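{- Let $G_{40}$ be the graph on vertex set $\{0,1,\ldots,39\}$ with exactly the following $54$ edges: $0\text{ - }1$, $0\text{ - }2$, $0\text{ - }39$, $1\text{ - }3$, $1\text{ - }12$, $2\text{ - }3$, $2\text{ - }4$, $3\text{ - }5$, $4\text{ - }6$, $5\text{ - }6$, $5\text{ - }7$, $6\text{ - }8$, $7\text{ - }9$, $7\text{ - }10$, $8\text{ - }9$, $8\text{ - }10$, $11\text{ - }12$, $11\text{ - }13$, $11\text{ - }22$, $12\text{ - }14$, $13\text{ - }14$, $13\text{ - }15$, $14\text{ - }16$, $15\text{ - }17$, $16\text{ - }17$, $16\text{ - }18$, $17\text{ - }19$, $18\text{ - }20$, $18\text{ - }21$, $19\text{ - }20$, $19\text{ - }21$, $22\text{ - }24$, $22\text{ - }30$, $23\text{ - }25$, $23\text{ - }30$, $24\text{ - }25$, $24\text{ - }26$, $25\text{ - }27$, $26\text{ - }28$, $26\text{ - }29$, $27\text{ - }28$, $27\text{ - }29$, $30\text{ - }31$, $31\text{ - }32$, $31\text{ - }39$, $32\text{ - }34$, $33\text{ - }34$, $33\text{ - }35$, $33\text{ - }39$, $34\text{ - }36$, $35\text{ - }37$, $35\text{ - }38$, $36\text{ - }37$, $36\text{ - }38$. Then $G_{40}$ is subcubic (maximum degree at most $3$), $2$-connected, has no $K_4$ minor, and has no crumby coloring.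
   Context: A red-blue coloring of the vertices of a graph is called crumby if (1) the subgraph induced by the blue vertices has maximum degree at most $1$, (2) every red vertex has at least one red neighbour, and (3) the subgraph induced by the red vertices contains no path on four vertices as a subgraph (not necessarily induced), i.e., there are no four distinct red vertices $v_1,v_2,v_3,v_4$ with $v_1v_2,v_2v_3,v_3v_4$ edges. -}

module Defs where

open import Data.Nat using (ℕ; zero; suc; _≤_; _≡ᵇ_)
open import Data.Bool using (Bool; true; false; _∧_; _∨_; not)
open import Data.Fin using (Fin; toℕ)
open import Data.List using (List; []; _∷_; length; filterᵇ)
open import Data.Bool.ListAction using (any)
open import Data.List.Base using (allFin)
open import Data.Product using (Σ; _×_; _,_; ∃; ∃-syntax)
open import Relation.Binary.PropositionalEquality using (_≡_; _≢_)

Graph : ℕ → Set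
Graph n = Fin n → Fin n → Bool

VSet : ℕ → Set
VSet n = Fin n → Bool

degIn : ∀ {n} → Graph n → VSet n → Fin n → ℕ
degIn {n} G S v = length (filterᵇ (λ w → G v w ∧ S w) (allFin n))

degree : ∀ {n} → Graph n → Fin n → ℕ
degree G v = degIn G (λ _ → true) v

MaxDegreeAtMost : ∀ {n} → Graph n → ℕ → Set
MaxDegreeAtMost G k = ∀ v → degree G v ≤ k

Subcubic : ∀ {n} → Graph n → Set
Subcubic G = MaxDegreeAtMost G 3

data Walk {n} (G : Graph n) (S : VSet n) : Fin n → Fin n → Set where
  here : ∀ {u} → S u ≡ true → Walk G S u u
  step : ∀ {u w v} → S u ≡ true → G u w ≡ true → Walk G S w v → Walk G S u v

ConnectedOn : ∀ {n} → Graph n → VSet n → Set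
ConnectedOn G S = ∀ u v → S u ≡ true → S v ≡ true → Walk G S u v

TwoConnected : ∀ {n} → Graph n → Set
TwoConnected {n} G =
  (3 ≤ n) × ConnectedOn G (λ _ → true)
          × (∀ (x : Fin n) → ConnectedOn G (λ v → not (toℕ v ≡ᵇ toℕ x)))

HasK4Minor : ∀ {n} → Graph n → Set
HasK4Minor {n} G =
  Σ (Fin 4 → VSet n) λ B →
    (∀ i → ∃[ v ] B i v ≡ true)
  × (∀ i j v → i ≢ j → B i v ≡ true → B j v ≡ true → Data.Empty.⊥)
  × (∀ i → ConnectedOn G (B i))
  × (∀ i j → i ≢ j → ∃[ u ] ∃[ v ] (B i u ≡ true × B j v ≡ true × G u v ≡ true))
  where import Data.Empty

Red Blue : ∀ {n} → VSet n → Fin n → Set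
Red col v = col v ≡ true
Blue col v = col v ≡ false

IsCrumby : ∀ {n} → Graph n → VSet n → Set
IsCrumby {n} G col =
    (∀ v → Blue col v → degIn G (λ w → not (col w)) v ≤ 1)
  × (∀ v → Red col v → ∃[ w ] (G v w ≡ true × Red col w))
  × (∀ (v₁ v₂ v₃ v₄ : Fin n) →
       Red col v₁ → Red col v₂ → Red col v₃ → Red col v₄ →
       v₁ ≢ v₂ → v₁ ≢ v₃ → v₁ ≢ v₄ → v₂ ≢ v₃ → v₂ ≢ v₄ → v₃ ≢ v₄ →
       G v₁ v₂ ≡ true → G v₂ v₃ ≡ true → G v₃ v₄ ≡ true → Data.Empty.⊥)
  where import Data.Empty

HasCrumbyColouring : ∀ {n} → Graph n → Set
HasCrumbyColouring {n} G = ∃[ col ] IsCrumby G col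

edges40 : List (ℕ × ℕ)
edges40 =
  (0 , 1) ∷ (0 , 2) ∷ (0 , 39) ∷ (1 , 3) ∷ (1 , 12) ∷ (2 , 3) ∷ (2 , 4) ∷
  (3 , 5) ∷ (4 , 6) ∷ (5 , 6) ∷ (5 , 7) ∷ (6 , 8) ∷ (7 , 9) ∷ (7 , 10) ∷
  (8 , 9) ∷ (8 , 10) ∷ (11 , 12) ∷ (11 , 13) ∷ (11 , 22) ∷ (12 , 14) ∷
  (13 , 14) ∷ (13 , 15) ∷ (14 , 16) ∷ (15 , 17) ∷ (16 , 17) ∷ (16 , 18) ∷
  (17 , 19) ∷ (18 , 20) ∷ (18 , 21) ∷ (19 , 20) ∷ (19 , 21) ∷ (22 , 24) ∷
  (22 , 30) ∷ (23 , 25) ∷ (23 , 30) ∷ (24 , 25) ∷ (24 , 26) ∷ (25 , 27) ∷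
  (26 , 28) ∷ (26 , 29) ∷ (27 , 28) ∷ (27 , 29) ∷ (30 , 31) ∷ (31 , 32) ∷
  (31 , 39) ∷ (32 , 34) ∷ (33 , 34) ∷ (33 , 35) ∷ (33 , 39) ∷ (34 , 36) ∷
  (35 , 37) ∷ (35 , 38) ∷ (36 , 37) ∷ (36 , 38) ∷ []

isEdge : ℕ → ℕ → (ℕ × ℕ) → Bool
isEdge a b (x , y) = ((a ≡ᵇ x) ∧ (b ≡ᵇ y)) ∨ ((a ≡ᵇ y) ∧ (b ≡ᵇ x))

G40 : Graph 40
G40 u v = any (isEdge (toℕ u) (toℕ v)) edges40

module Submission where

-- 2-connectedness is read off an st-numbering.  Absence of a K₄ minor comes from a width-2
-- elimination order: among four branch sets, one whose topmost vertex t is lowest can only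
-- reach the other three through the two later neighbours of t.  A crumby colouring satisfies
-- a CNF formula (no all-blue P₃, no all-red P₄, a red neighbour for every red vertex), which
-- is refuted by branching; clauses learned on the pieces of G₄₀ hanging off small cuts
-- keep the case analysis small.

open import Defs
open import Agda.Builtin.FromNat using (Number; fromNat)
open import Data.Bool using (Bool; true; false; not; _∧_)
open import Data.Bool.ListAction using (all)
open import Data.Bool.Properties
  using (¬-not; not-¬; not-injective; not-involutive; T-≡)
  renaming (_≟_ to _≟ᵇ_)
open import Data.Empty using (⊥-elim)
open import Data.Fin using (Fin; zero; suc; toℕ; punchIn; _≟_)
open import Data.Fin.Literals using () renaming (number to finNumber)
open import Data.Fin.Properties
  using (all?; any?; pigeonhole; punchIn-injective; punchInᵢ≢i; toℕ-injective; <⇒≢)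
open import Data.List using (List; []; _∷_; _++_; map; filter; filterᵇ; concatMap; length; allFin)
open import Data.List.Extrema.Nat using (argmin; argmin-all)
open import Data.List.Membership.Propositional using (_∈_)
open import Data.List.Membership.Propositional.Properties using (∈-allFin; ∈-filter⁺; ∈-filter⁻; ∈-map⁺)
open import Data.List.Relation.Unary.All as All using (All; []; _∷_)
open import Data.List.Relation.Unary.All.Properties as All using (¬Any⇒All¬)
open import Data.List.Relation.Unary.Any as Any using (Any; here; there)
open import Data.Nat using (ℕ; zero; suc; _≤_; _<_; _≡ᵇ_; _∸_; z≤n; s≤s; _≤?_; _<?_)
open import Data.Nat.Induction using (<-wellFounded)
open import Data.Nat.Literals using () renaming (number to natNumber)
open import Data.Nat.Properties
  using (≤-refl; ≤-trans; ≤-antisym; <⇒≤; <⇒≱; ≰⇒>; ≡ᵇ⇒≡; ≡⇒≡ᵇ)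
  renaming (_≟_ to _≟ⁿ_)
open import Data.Product using (_×_; _,_; proj₁; proj₂; ∃-syntax)
open import Data.Product.Properties using (≡-dec)
open import Data.Sum using (_⊎_; inj₁; inj₂)
open import Data.Unit using (tt)
open import Data.Vec using (Vec; _∷_; []; head; last; lookup; toList)
open import Data.Vec.Membership.Propositional using () renaming (_∈_ to _∈ᵛ_)
open import Data.Vec.Relation.Unary.All as AllV using ([]; _∷_)
open import Data.Vec.Relation.Unary.AllPairs using (AllPairs; []; _∷_)
open import Data.Vec.Relation.Unary.Any using (here; there)
open import Data.Vec.Relation.Unary.Linked using (Linked; [-]; _∷_)
open import Function using (_∘_; Equivalence)
open import Induction.WellFounded using (Acc; acc)
open import Relation.Binary.Definitions using (DecidableEquality)
open import Relation.Binary.PropositionalEquality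
  using (_≡_; _≢_; refl; sym; trans; cong; cong₂; subst; ≢-sym)
open import Relation.Nullary using (¬_; Dec; yes; no)
open import Relation.Nullary.Decidable
  using (from-yes; _×-dec_; _⊎-dec_; _→-dec_; ¬?; T?)

instance
  ℕ-number : Number ℕ
  ℕ-number = natNumber

  Fin-number : ∀ {n} → Number (Fin n)
  Fin-number {n} = finNumber n

private
  variable
    n : ℕ

-- Walks inside a vertex set

module _ {G : Graph n} {S : VSet n} where

  start∈ : ∀ {u v} → Walk G S u v → S u ≡ true
  start∈ (here su)     = su
  start∈ (step su _ _) = su

  _◅◅_ : ∀ {u v w} → Walk G S u v → Walk G S v w → Walk G S u w
  here _       ◅◅ q = q
  step su e p  ◅◅ q = step su e (p ◅◅ q)

  reverse : (∀ u v → G u v ≡ true → G v u ≡ true) → ∀ {u v} → Walk G S u v → Walk G S v u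
  reverse G-sym (here su)     = here su
  reverse G-sym (step su e p) =
    reverse G-sym p ◅◅ step (start∈ p) (G-sym _ _ e) (here su)

-- Two-connectedness

-- An st-numbering given by two potentials: f strictly decreases along some path to s and
-- g along some path to t.  Deleting x, the vertices of smaller f-value still descend to s,
-- all others still descend to t, and s, t are adjacent.
module STNumbering
  (G : Graph n) (G-sym : ∀ u v → G u v ≡ true → G v u ≡ true)
  (f g : Fin n → ℕ) (s t : Fin n) (st : G s t ≡ true)
  (f-descends : ∀ v → v ≡ s ⊎ ∃[ w ] (G v w ≡ true × f w < f v))
  (g-descends : ∀ v → v ≡ t ⊎ ∃[ w ] (G v w ≡ true × g w < g v))
  where

  -- The walk visits only vertices whose `h`-value is at most `h v`, so `S` need contain no more
  -- than that sublevel set. This serves the whole graph and the graph minus a vertex alike.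
  descend : ∀ (S : VSet n) (h : Fin n → ℕ) (r : Fin n) →
            (∀ v → v ≡ r ⊎ ∃[ w ] (G v w ≡ true × h w < h v)) →
            ∀ v → Acc _<_ (h v) → (∀ u → h u ≤ h v → S u ≡ true) → Walk G S v r
  descend S h r descends v (acc rec) below with descends v
  ... | inj₁ refl          = here (below v ≤-refl)
  ... | inj₂ (w , e , w<v) =
    step (below v ≤-refl) e
      (descend S h r descends w (rec w<v) λ u u≤w → below u (≤-trans u≤w (<⇒≤ w<v)))

  to-s : ∀ S v → (∀ u → f u ≤ f v → S u ≡ true) → Walk G S v s
  to-s S v = descend S f s f-descends v (<-wellFounded _)

  to-t : ∀ S v → (∀ u → g u ≤ g v → S u ≡ true) → Walk G S v t
  to-t S v = descend S g t g-descends v (<-wellFounded _)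

  bridge : ∀ {S p q u v} → G p q ≡ true → Walk G S u p → Walk G S v q → Walk G S u v
  bridge e up vq = up ◅◅ step (start∈ (reverse G-sym up)) e (reverse G-sym vq)

  connected : ConnectedOn G (λ _ → true)
  connected u v _ _ = to-s _ u (λ _ _ → refl) ◅◅ reverse G-sym (to-s _ v (λ _ _ → refl))

  module _ (compare : ∀ v x → v ≢ x → f v < f x ⊎ g v < g x) where

    without : Fin n → VSet n
    without x v = not (toℕ v ≡ᵇ toℕ x)

    ≢⇒without : ∀ {x u} → u ≢ x → without x u ≡ true
    ≢⇒without u≢x = cong not (¬-not λ eq → u≢x (toℕ-injective (≡ᵇ⇒≡ _ _ (Equivalence.from T-≡ eq))))

    without⇒≢ : ∀ {x u} → without x u ≡ true → u ≢ x
    without⇒≢ {x} x∈ refl =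
      not-¬ (Equivalence.to T-≡ (≡⇒≡ᵇ (toℕ x) _ refl)) (not-injective x∈)

    avoids : (h : Fin n → ℕ) → ∀ {v x} → h v < h x → ∀ u → h u ≤ h v → without x u ≡ true
    avoids h {x = x} v<x u u≤v = ≢⇒without {x} {u} λ { refl → <⇒≱ v<x u≤v }

    connected-without : ∀ x → ConnectedOn G (without x)
    connected-without x u v u∈ v∈
      with compare u x (without⇒≢ u∈) | compare v x (without⇒≢ v∈)
    ... | inj₁ u<x | inj₁ v<x =
      to-s _ u (avoids f u<x) ◅◅ reverse G-sym (to-s _ v (avoids f v<x))
    ... | inj₂ u<x | inj₂ v<x =
      to-t _ u (avoids g u<x) ◅◅ reverse G-sym (to-t _ v (avoids g v<x))
    ... | inj₁ u<x | inj₂ v<x = bridge st (to-s _ u (avoids f u<x)) (to-t _ v (avoids g v<x))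
    ... | inj₂ u<x | inj₁ v<x =
      bridge (G-sym _ _ st) (to-t _ u (avoids g u<x)) (to-s _ v (avoids f v<x))

-- Excluding a K₄ minor

-- A width-2 elimination order.  Below t is the subtree of t in the elimination tree, which
-- in postorder is an interval of ranks; an edge leaves it only towards one of the two later
-- neighbours of t in the fill-in graph.
module Elimination
  (G : Graph n) (rank low : Fin n → ℕ) (up₁ up₂ : Fin n → Fin n)
  where

  Below : Fin n → Fin n → Set
  Below t u = low t ≤ rank u × rank u ≤ rank t

  Exit : Fin n → Fin n → Set
  Exit t w = rank t < rank w × (w ≡ up₁ t ⊎ w ≡ up₂ t)

  below? : ∀ t u → Dec (Below t u)
  below? t u = (low t ≤? rank u) ×-dec (rank u ≤? rank t)

  exit? : ∀ t w → Dec (Exit t w)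
  exit? t w = (rank t <? rank w) ×-dec ((w ≟ up₁ t) ⊎-dec (w ≟ up₂ t))

  module _
    (rank-injective : ∀ u v → rank u ≡ rank v → u ≡ v)
    (rank<n : ∀ v → rank v < n)
    (low≤rank : ∀ t → low t ≤ rank t)
    (edge-exits : ∀ u w → G u w ≡ true → ∀ t → Below t u → Below t w ⊎ Exit t w)
    where

    -- The first vertex of the walk outside the subtree is an exit, and it lies in `S` because the
    -- walk does.
    walk-exits : ∀ {S t u v} → Walk G S u v → Below t u →
                 Below t v ⊎ ∃[ w ] (S w ≡ true × Exit t w)
    walk-exits (here _)     u∈ = inj₁ u∈
    walk-exits (step _ e p) u∈ with edge-exits _ _ e _ u∈
    ... | inj₁ w∈ = walk-exits p w∈
    ... | inj₂ ex = inj₂ (_ , start∈ p , ex)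

    noK4Minor : ¬ HasK4Minor G
    noK4Minor (B , nonempty , disjoint , conn , touch) =
      -- Ranks stay below `n`, so reaching rank `n` is absurd for any branch set.
      let _ , _ , n≤r = reaches n zero in <⇒≱ (rank<n _) n≤r
      where
      -- The topmost vertex t of a branch set i confined to ranks ≤ k would be cut off by
      -- up₁ t and up₂ t, yet three other branch sets must be reached.
      reaches : ∀ k i → ∃[ u ] (B i u ≡ true × k ≤ rank u)
      reaches zero    i = let u , u∈ = nonempty i in u , u∈ , z≤n
      reaches (suc k) i with any? (λ u → (B i u ≟ᵇ true) ×-dec (suc k ≤? rank u))
      ... | yes found = found
      -- `≤-refl` proves `2 < 3`: three other branch sets, two possible exits.
      ... | no  none  = ⊥-elim (crowded (pigeonhole ≤-refl side))
        where
        t = proj₁ (reaches k i)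

        t∈ : B i t ≡ true
        t∈ = proj₁ (proj₂ (reaches k i))

        k≤t : k ≤ rank t
        k≤t = proj₂ (proj₂ (reaches k i))

        ¬exit : ∀ {w} → B i w ≡ true → ¬ Exit t w
        ¬exit w∈ (t<w , _) = none (_ , w∈ , ≤-trans (s≤s k≤t) t<w)

        t≤k : rank t ≤ k
        t≤k with rank t ≤? k
        ... | yes t≤k = t≤k
        ... | no  t≰k = ⊥-elim (none (t , t∈ , ≰⇒> t≰k))

        exit : ∀ j → i ≢ j → ∃[ w ] (B j w ≡ true × Exit t w)
        exit j i≢j with touch i j i≢j
        -- Branch set `i` has nothing ranked above `t`, so its walk from `t` to `u` stays in the
        -- subtree.
        ... | u , v , u∈ , v∈ , e with walk-exits (conn i t u t∈ u∈) (low≤rank t , ≤-refl)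
        ...   | inj₂ (w , w∈ , ex) = ⊥-elim (¬exit w∈ ex)
        ...   | inj₁ tu with edge-exits u v e t tu
        ...     | inj₂ ex = v , v∈ , ex
        -- By induction branch set `j` also has a vertex `x` of rank at least `k`. As `t` has rank
        -- exactly `k`, finding `x` in the subtree would force `x` to be `t`; so a walk from `v` to
        -- `x` must exit.
        ...     | inj₁ tv with reaches k j
        ...       | x , x∈ , k≤x with walk-exits (conn j v x v∈ x∈) tv
        ...         | inj₂ found     = found
        ...         | inj₁ (_ , x≤t) =
          ⊥-elim (disjoint i j x i≢j (subst (λ y → B i y ≡ true) t≡x t∈) x∈)
          where t≡x = rank-injective t x (≤-antisym (≤-trans t≤k k≤x) x≤t)

        other : ∀ m → ∃[ w ] (B (punchIn i m) w ≡ true × Exit t w)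
        other m = exit (punchIn i m) (≢-sym (punchInᵢ≢i i m))

        choose : ∀ {w} → Exit t w → Fin 2
        choose (_ , inj₁ _) = 0
        choose (_ , inj₂ _) = 1

        choose-injective : ∀ {w x} (p : Exit t w) (q : Exit t x) → choose p ≡ choose q → w ≡ x
        choose-injective (_ , inj₁ refl) (_ , inj₁ refl) _ = refl
        choose-injective (_ , inj₂ refl) (_ , inj₂ refl) _ = refl

        side : Fin 3 → Fin 2
        side m = choose (proj₂ (proj₂ (other m)))

        crowded : ¬ (∃[ l ] ∃[ m ] (toℕ l < toℕ m × side l ≡ side m))
        crowded (l , m , l<m , eq) with other l | other m
        ... | w , w∈ , p | x , x∈ , q with choose-injective p q eq
        ...   | refl = disjoint _ _ w (<⇒≢ l<m ∘ punchIn-injective i l m) w∈ x∈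

-- A verified refuter for clause sets

module Resolution {V : Set} (_≟ᵛ_ : DecidableEquality V) where

  open import Data.List.Membership.DecPropositional _≟ᵛ_ using (_∈?_)

  Literal Clause : Set
  Literal = V × Bool
  Clause  = List Literal

  Sat : (V → Bool) → Clause → Set
  Sat σ = Any λ (x , b) → σ x ≡ b

  _≟ˡ_ : DecidableEquality Literal
  _≟ˡ_ = ≡-dec _≟ᵛ_ _≟ᵇ_

  assign : V → Bool → List Clause → List Clause
  assign x b cs =
    map (filter (λ l → ¬? (l ≟ˡ (x , not b)))) (filter (λ c → ¬? (Any.any? (_≟ˡ (x , b)) c)) cs)

  -- Branching on a shortest clause makes unit propagation a special case of branching.
  unsat : ℕ → List Clause → Bool
  -- Exhausted fuel answers `false`, so `true` always comes from a completed refutation.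
  unsat zero       _        = false
  unsat (suc _)    []       = false
  unsat (suc fuel) (c ∷ cs) with argmin length c cs
  ... | []          = true
  ... | (x , b) ∷ _ = unsat fuel (assign x b (c ∷ cs)) ∧ unsat fuel (assign x (not b) (c ∷ cs))

  record Region : Set where
    constructor _⊢_
    field
      scope   : List V
      learned : List Clause

  open Region

  within : List V → List Clause → List Clause
  within vs = filter (All.all? (λ l → proj₁ l ∈? vs))

  negation : Clause → List Clause
  negation = map λ (x , b) → (x , not b) ∷ []

  entails : ℕ → List Clause → List Clause → Bool
  entails fuel cs = all λ d → unsat fuel (negation d ++ cs)

  -- Learned clauses are derived only from clauses confined to the scope, which keeps each search
  -- local; they then join the clauses available to later regions.
  refutes : ℕ → List Region → List Clause → Bool
  refutes fuel []       cs = unsat fuel cs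
  refutes fuel (r ∷ rs) cs =
    entails fuel (within (scope r) cs) (learned r) ∧ refutes fuel rs (learned r ++ cs)

  module _ {σ : V → Bool} where

    ∧-true : ∀ a {b} → a ∧ b ≡ true → a ≡ true × b ≡ true
    ∧-true true eq = refl , eq

    -- A literal witnessing satisfaction has the form `(x , σ x)`, so a filter keeping all such
    -- literals keeps the witness.
    sat-filter : ∀ {P : Literal → Set} (P? : ∀ l → Dec (P l)) {c} →
                 (∀ {x} → P (x , σ x)) → Sat σ c → Sat σ (filter P? c)
    sat-filter P? {(x , b) ∷ _} true-kept (here refl) with P? (x , b)
    ... | yes _  = here refl
    ... | no  ¬p = ⊥-elim (¬p true-kept)
    sat-filter P? {l ∷ _} true-kept (there p) with P? l
    ... | yes _ = there (sat-filter P? true-kept p)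
    ... | no  _ = sat-filter P? true-kept p

    sat-assign : ∀ {x b cs} → σ x ≡ b → All (Sat σ) cs → All (Sat σ) (assign x b cs)
    sat-assign {x} refl sats =
      All.map⁺ (All.map (sat-filter _ kept) (All.filter⁺ _ sats))
      where
      kept : ∀ {y} → (y , σ y) ≢ (x , not (σ x))
      kept eq = not-¬ (sym (trans (cong proj₂ eq) (cong (not ∘ σ) (sym (cong proj₁ eq))))) refl

    unsat-sound : ∀ fuel cs → unsat fuel cs ≡ true → ¬ All (Sat σ) cs
    unsat-sound (suc fuel) (c ∷ cs) ok (sc ∷ scs)
      -- The selected clause is itself satisfied; carrying this proof along rules out the empty
      -- clause.
      with argmin length c cs | argmin-all length {xs = cs} {P = Sat σ} sc scs
    ... | (x , b) ∷ _ | _ with ∧-true (unsat fuel (assign x b (c ∷ cs))) ok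
    ...   | ok₁ , ok₂ with σ x ≟ᵇ b
    ...     | yes eq = unsat-sound fuel _ ok₁ (sat-assign eq (sc ∷ scs))
    ...     | no neq = unsat-sound fuel _ ok₂ (sat-assign (¬-not neq) (sc ∷ scs))

    sat-negation : ∀ {c} → ¬ Sat σ c → All (Sat σ) (negation c)
    sat-negation ¬sat = All.map⁺ (All.map (here ∘ ¬-not) (¬Any⇒All¬ _ ¬sat))

    sat? : ∀ c → Dec (Sat σ c)
    sat? = Any.any? λ (x , b) → σ x ≟ᵇ b

    entails-sound : ∀ fuel cs ds → entails fuel cs ds ≡ true → All (Sat σ) cs → All (Sat σ) ds
    entails-sound fuel cs []       ok sats = []
    entails-sound fuel cs (d ∷ ds) ok sats with ∧-true (unsat fuel (negation d ++ cs)) ok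
    ... | ok₁ , ok₂ with sat? d
    ...   | yes sd = sd ∷ entails-sound fuel cs ds ok₂ sats
    ...   | no ¬sd = ⊥-elim (unsat-sound fuel _ ok₁ (All.++⁺ (sat-negation {d} ¬sd) sats))

    refutes-sound : ∀ fuel rs cs → refutes fuel rs cs ≡ true → ¬ All (Sat σ) cs
    refutes-sound fuel []       cs ok sats = unsat-sound fuel cs ok sats
    refutes-sound fuel (r ∷ rs) cs ok sats
      with ∧-true (entails fuel (within (scope r) cs) (learned r)) ok
    ... | ok₁ , ok₂ = refutes-sound fuel rs _ ok₂
      (All.++⁺ (entails-sound fuel _ (learned r) ok₁ (All.filter⁺ _ sats)) sats)

-- Crumby colourings as a CNF formula

module CrumbyClauses (G : Graph n) (G-sym : ∀ u v → G u v ≡ true → G v u ≡ true) where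

  open Resolution (_≟_ {n}) public
  open import Data.Vec.Membership.DecPropositional (_≟_ {n}) using () renaming (_∈?_ to _∈ᵛ?_)

  neighbours : Fin n → List (Fin n)
  neighbours v = filter (λ w → G v w ≟ᵇ true) (allFin n)

  IsPath : ∀ {k} → Vec (Fin n) k → Set
  IsPath p = Linked (λ v w → G v w ≡ true) p × AllPairs _≢_ p

  extend : ∀ {k} → Vec (Fin n) (suc k) → List (Vec (Fin n) (suc (suc k)))
  extend p = map (_∷ p) (filter (λ w → ¬? (w ∈ᵛ? p)) (neighbours (head p)))

  paths : ∀ k → List (Vec (Fin n) (suc k))
  paths zero    = map (_∷ []) (allFin n)
  paths (suc k) = concatMap extend (paths k)

  notAll : Bool → ∀ k → List Clause
  notAll b k = map (λ p → map (_, not b) (toList p))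
    -- A path and its reversal give the same clause up to order; one orientation is kept.
    (filter (λ p → toℕ (head p) <? toℕ (last p)) (paths k))

  redClause : Fin n → Clause
  redClause v = (v , false) ∷ map (_, true) (neighbours v)

  -- The numbers count edges: `2` forbids a blue P₃, which is two blue neighbours at a blue vertex,
  -- and `3` forbids a red P₄.
  clauses : List Clause
  clauses = notAll false 2 ++ map redClause (allFin n) ++ notAll true 3

  ∈-neighbours⁺ : ∀ {v w} → G v w ≡ true → w ∈ neighbours v
  ∈-neighbours⁺ {v} = ∈-filter⁺ (λ w → G v w ≟ᵇ true) (∈-allFin _)

  extend-isPath : ∀ {k} {p : Vec (Fin n) (suc k)} → IsPath p → All IsPath (extend p)
  extend-isPath {p = v ∷ p} (linked , unique) =
    All.map⁺ (All.tabulate λ {w} w∈ →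
      let w∈nv , w∉p = ∈-filter⁻ (λ w → ¬? (w ∈ᵛ? (v ∷ p))) w∈
          _    , e   = ∈-filter⁻ (λ w → G v w ≟ᵇ true) {xs = allFin n} w∈nv
      in G-sym v w e ∷ linked , ∉⇒All w∉p ∷ unique)
    where
    ∉⇒All : ∀ {k w} {q : Vec (Fin n) k} → ¬ w ∈ᵛ q → AllV.All (w ≢_) q
    ∉⇒All {q = []}    _  = []
    ∉⇒All {q = _ ∷ _} w∉ = w∉ ∘ here ∷ ∉⇒All (w∉ ∘ there)

  paths-isPath : ∀ k → All IsPath (paths k)
  paths-isPath zero    = All.map⁺ (All.universal (λ _ → [-] , [] ∷ []) (allFin n))
  paths-isPath (suc k) = All.concat⁺ (All.map⁺ (All.map extend-isPath (paths-isPath k)))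

  module _ {col : VSet n} where

    sat-unless : ∀ {c} → ¬ All (λ (x , b) → col x ≡ not b) c → Sat col c
    sat-unless {c} h with sat? c
    ... | yes sat = sat
    ... | no ¬sat = ⊥-elim (h (All.map ¬-not (¬Any⇒All¬ _ ¬sat)))

    notAll-sat : ∀ b k →
                 (∀ {p : Vec (Fin n) (suc k)} → IsPath p → ¬ All (λ v → col v ≡ b) (toList p)) →
                 All (Sat col) (notAll b k)
    notAll-sat b k h = All.map⁺ (All.filter⁺ _ (All.map
      (λ isPath → sat-unless (h isPath ∘ All.map (λ eq → trans eq (not-involutive b)) ∘ All.map⁻))
      (paths-isPath k)))

    clauses-sat : IsCrumby G col → All (Sat col) clauses
    clauses-sat (blue , red , path) =
      All.++⁺ (notAll-sat false 2 no-blue-P₃)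
        (All.++⁺ (All.map⁺ (All.universal red-sat (allFin n))) (notAll-sat true 3 no-red-P₄))
      where
      length≤1⇒≡ : ∀ {A : Set} {xs : List A} {x y} → length xs ≤ 1 → x ∈ xs → y ∈ xs → x ≡ y
      length≤1⇒≡ {xs = _ ∷ []}    _        (here refl) (here refl) = refl
      length≤1⇒≡ {xs = _ ∷ _ ∷ _} (s≤s ())

      blue-neighbour : ∀ v w → G v w ≡ true → col w ≡ false →
                       w ∈ filterᵇ (λ w → G v w ∧ not (col w)) (allFin n)
      blue-neighbour v w e bw = ∈-filter⁺ (λ w → T? (G v w ∧ not (col w))) (∈-allFin w)
        (Equivalence.from T-≡ (cong₂ (λ a b → a ∧ not b) e bw))

      no-blue-P₃ : ∀ {p : Vec (Fin n) 3} → IsPath p → ¬ All (λ v → col v ≡ false) (toList p)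
      no-blue-P₃ {u ∷ v ∷ w ∷ []} (uv ∷ vw ∷ [-] , (_ ∷ u≢w ∷ []) ∷ _) (bu ∷ bv ∷ bw ∷ []) =
        u≢w (length≤1⇒≡ (blue v bv) (blue-neighbour v u (G-sym u v uv) bu) (blue-neighbour v w vw bw))

      no-red-P₄ : ∀ {p : Vec (Fin n) 4} → IsPath p → ¬ All (λ v → col v ≡ true) (toList p)
      no-red-P₄ {a ∷ b ∷ c ∷ d ∷ []}
        (ab ∷ bc ∷ cd ∷ [-] , (a≢b ∷ a≢c ∷ a≢d ∷ []) ∷ (b≢c ∷ b≢d ∷ []) ∷ (c≢d ∷ []) ∷ _)
        (ra ∷ rb ∷ rc ∷ rd ∷ []) =
        path a b c d ra rb rc rd a≢b a≢c a≢d b≢c b≢d c≢d ab bc cd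

      red-sat : ∀ v → Sat col (redClause v)
      red-sat v with col v in eq
      ... | false = here eq
      ... | true  with red v eq
      ...   | w , e , rw = there (Any.map (λ { refl → rw }) (∈-map⁺ (_, true) (∈-neighbours⁺ e)))

-- Certificates for `G40`

subcubic : Subcubic G40
subcubic = from-yes (all? λ v → degree G40 v ≤? 3)

G40-sym : ∀ u v → G40 u v ≡ true → G40 v u ≡ true
G40-sym = from-yes (all? λ u → all? λ v → (G40 u v ≟ᵇ true) →-dec (G40 v u ≟ᵇ true))

-- A bijection onto 0 to 39 that goes out along one side of each gadget and back along the other.
-- Its reversal `39 ∸ stNumber v` is the second potential.
stNumber : Fin 40 → ℕ
stNumber = lookup
  (0 ∷ 10 ∷ 1 ∷ 9 ∷ 2 ∷ 8 ∷ 3 ∷ 7 ∷ 4 ∷ 6 ∷ 5 ∷ 21 ∷ 11 ∷ 20 ∷ 12 ∷ 19 ∷ 13 ∷ 18 ∷ 14 ∷ 17 ∷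
   16 ∷ 15 ∷ 22 ∷ 29 ∷ 23 ∷ 28 ∷ 24 ∷ 27 ∷ 26 ∷ 25 ∷ 30 ∷ 31 ∷ 32 ∷ 38 ∷ 33 ∷ 37 ∷ 34 ∷ 36 ∷ 35 ∷ 39 ∷ [])

twoConnected : TwoConnected G40
twoConnected =
  from-yes (3 ≤? 40) , connected , connected-without
    (from-yes (all? λ v → all? λ x →
      ¬? (v ≟ x) →-dec ((stNumber v <? stNumber x) ⊎-dec (39 ∸ stNumber v <? 39 ∸ stNumber x))))
  where
  descends? : ∀ (h : Fin 40 → ℕ) r → Dec (∀ v → v ≡ r ⊎ ∃[ w ] (G40 v w ≡ true × h w < h v))
  descends? h r = all? λ v → (v ≟ r) ⊎-dec any? λ w → (G40 v w ≟ᵇ true) ×-dec (h w <? h v)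

  open STNumbering G40 G40-sym stNumber (λ v → 39 ∸ stNumber v) 0 39 refl
    (from-yes (descends? stNumber 0)) (from-yes (descends? (λ v → 39 ∸ stNumber v) 39))

rank low : Fin 40 → ℕ
rank = lookup
  (9 ∷ 10 ∷ 7 ∷ 8 ∷ 0 ∷ 5 ∷ 6 ∷ 3 ∷ 4 ∷ 1 ∷ 2 ∷ 20 ∷ 21 ∷ 18 ∷ 19 ∷ 11 ∷ 16 ∷ 17 ∷ 14 ∷ 15 ∷
   12 ∷ 13 ∷ 29 ∷ 22 ∷ 27 ∷ 28 ∷ 25 ∷ 26 ∷ 23 ∷ 24 ∷ 30 ∷ 31 ∷ 32 ∷ 37 ∷ 38 ∷ 35 ∷ 36 ∷ 33 ∷ 34 ∷ 39 ∷ [])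
low = lookup
  (0 ∷ 0 ∷ 0 ∷ 0 ∷ 0 ∷ 1 ∷ 0 ∷ 1 ∷ 1 ∷ 1 ∷ 2 ∷ 11 ∷ 0 ∷ 11 ∷ 11 ∷ 11 ∷ 12 ∷ 11 ∷ 12 ∷ 12 ∷
   12 ∷ 13 ∷ 0 ∷ 22 ∷ 23 ∷ 22 ∷ 23 ∷ 23 ∷ 23 ∷ 24 ∷ 0 ∷ 0 ∷ 0 ∷ 33 ∷ 0 ∷ 33 ∷ 33 ∷ 33 ∷ 34 ∷ 0 ∷ [])

-- Vertices 34 and 39 have fewer than two later neighbours and fill the spare places with
-- themselves; the rank condition in `Exit` rejects these entries.
up₁ up₂ : Fin 40 → Fin 40
up₁ = lookup
  (1 ∷ 12 ∷ 0 ∷ 0 ∷ 2 ∷ 3 ∷ 2 ∷ 5 ∷ 5 ∷ 7 ∷ 7 ∷ 12 ∷ 22 ∷ 11 ∷ 11 ∷ 13 ∷ 14 ∷ 13 ∷ 16 ∷ 16 ∷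
   18 ∷ 18 ∷ 30 ∷ 25 ∷ 22 ∷ 22 ∷ 24 ∷ 24 ∷ 26 ∷ 26 ∷ 31 ∷ 32 ∷ 34 ∷ 34 ∷ 39 ∷ 33 ∷ 33 ∷ 35 ∷ 35 ∷ 39 ∷ [])
up₂ = lookup
  (39 ∷ 39 ∷ 3 ∷ 1 ∷ 6 ∷ 6 ∷ 3 ∷ 8 ∷ 6 ∷ 8 ∷ 8 ∷ 22 ∷ 39 ∷ 14 ∷ 12 ∷ 17 ∷ 17 ∷ 14 ∷ 19 ∷ 17 ∷
   19 ∷ 19 ∷ 39 ∷ 30 ∷ 25 ∷ 30 ∷ 27 ∷ 25 ∷ 27 ∷ 27 ∷ 39 ∷ 39 ∷ 39 ∷ 39 ∷ 34 ∷ 36 ∷ 34 ∷ 36 ∷ 36 ∷ 39 ∷ [])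

noK4Minor40 : ¬ HasK4Minor G40
noK4Minor40 = noK4Minor
  (from-yes (all? λ u → all? λ v → (rank u ≟ⁿ rank v) →-dec (u ≟ v)))
  (from-yes (all? λ v → rank v <? 40))
  (from-yes (all? λ t → low t ≤? rank t))
  (from-yes (all? λ u → all? λ w → (G40 u w ≟ᵇ true) →-dec
    all? λ t → below? t u →-dec (below? t w ⊎-dec exit? t w)))
  where open Elimination G40 rank low up₁ up₂

open CrumbyClauses G40 G40-sym

red blue : Fin 40 → Literal
red  v = v , true
blue v = v , false

-- Each of the first four regions is a gadget together with the vertices attaching it to the
-- rest; its learned clauses mention only vertices of the last region, where they clash.
regions : List Region
regions =
    ((0 ∷ 1 ∷ 2 ∷ 3 ∷ 4 ∷ 5 ∷ 6 ∷ 7 ∷ 8 ∷ 9 ∷ 10 ∷ [])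
      ⊢ ((blue 0 ∷ blue 1 ∷ blue 5 ∷ [])
        ∷ (blue 0 ∷ red 3 ∷ red 5 ∷ [])
        ∷ (blue 0 ∷ red 4 ∷ blue 5 ∷ [])
        ∷ (blue 3 ∷ blue 4 ∷ blue 5 ∷ []) ∷ []))
  ∷ ((0 ∷ 31 ∷ 32 ∷ 33 ∷ 34 ∷ 35 ∷ 36 ∷ 37 ∷ 38 ∷ 39 ∷ [])
      ⊢ ((red 39 ∷ red 32 ∷ [])
        ∷ (blue 33 ∷ blue 34 ∷ []) ∷ []))
  ∷ ((1 ∷ 11 ∷ 12 ∷ 13 ∷ 14 ∷ 15 ∷ 16 ∷ 17 ∷ 18 ∷ 19 ∷ 20 ∷ 21 ∷ 22 ∷ [])
      ⊢ ((red 12 ∷ red 13 ∷ [])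
        ∷ (blue 11 ∷ blue 12 ∷ red 14 ∷ [])
        ∷ (red 12 ∷ blue 22 ∷ red 14 ∷ []) ∷ []))
  ∷ ((11 ∷ 22 ∷ 23 ∷ 24 ∷ 25 ∷ 26 ∷ 27 ∷ 28 ∷ 29 ∷ 30 ∷ [])
      ⊢ ((red 22 ∷ red 23 ∷ [])
        ∷ (blue 24 ∷ red 30 ∷ []) ∷ []))
  ∷ ((0 ∷ 1 ∷ 2 ∷ 3 ∷ 4 ∷ 5 ∷ 11 ∷ 12 ∷ 13 ∷ 14
      ∷ 22 ∷ 23 ∷ 24 ∷ 25 ∷ 30 ∷ 31 ∷ 32 ∷ 33 ∷ 34 ∷ 39 ∷ [])
      -- Learning the empty clause is the contradiction itself; the closing `unsat` call finds it at
      -- once.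
      ⊢ ([] ∷ []))
  ∷ []

noCrumbyColouring : ¬ HasCrumbyColouring G40
noCrumbyColouring (col , crumby) =
  -- Each branching eliminates one of the 40 vertices, hence the fuel; `refl` runs the search.
  refutes-sound 40 regions clauses refl (clauses-sat crumby)

theorem4 : Subcubic G40 × TwoConnected G40 × ¬ HasK4Minor G40 × ¬ HasCrumbyColouring G40
theorem4 = subcubic , twoConnected , noK4Minor40 , noCrumbyColouring
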